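{- Let $p$ be an odd prime, $f(x)\in\mathbb{Z}[x]$, $n\ge2$, and let $\sigma$ be a cycle of $f_n$ which grows. Then its unique lift $\tilde\sigma$, a cycle of $f_{n+1}$, also grows; consequently the lift of $\tilde\sigma$ also grows, and so on for all successive lifts.
   Context: $f_n:\mathbb{Z}/p^n\mathbb{Z}\to\mathbb{Z}/p^n\mathbb{Z}$ is the map $x\mapsto f(x)\bmod p^n$. Let $\sigma=(x_1,\dots,x_k)$ be a cycle of $f_n$ of length $k$ (distinct elements, $f_n(x_i)=x_{i+1}$, $f_n(x_k)=x_1$), with the $x_i$ viewed as integers representing their classes. Put $g=f^k$ ($k$-th iterate), $a_n=g'(x_1)$, $b_n=(g(x_1)-x_1)/p^n$. A lift of $\sigma$ is a cycle of $f_{n+1}$ all of whose elements reduce mod $p^n$ to elements of $\sigma$. The cycle $\sigma$ grows if $a_n\equiv1\pmod p$ and $b_n\not\equiv0\pmod p$ (this is independent of the choices); in that case the elements of $\mathbb{Z}/p^{n+1}\mathbb{Z}$ reducing to elements of $\sigma$ form a single cycle of $f_{n+1}$, of length $pk$, which is the unique lift of $\sigma$. -}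

module Defs where

open import Data.Fin using (Fin; zero; suc; inject₁; fromℕ)
open import Data.Integer using (ℤ; +_; _+_; _-_; _*_; _/_; 0ℤ; 1ℤ)
open import Data.Integer.Divisibility using (_∣_)
open import Data.List using (List; []; _∷_; map)
open import Data.Nat as ℕ using (ℕ; zero; suc; NonZero)
import Data.Nat.Properties as ℕ
open import Data.Product using (_×_; ∃)
open import Function.Definitions using (Injective)
open import Relation.Binary.PropositionalEquality using (_≡_)
open import Relation.Nullary using (¬_)

infix 4 _≡_[mod_] _≋_ _IsLiftOf_ _IsSuccessiveLiftOf_

-- ℤ/N is the setoid of integers under this relation: a class is given by any
-- integer representing it, and a polynomial acts on classes by evaluation.

_≡_[mod_] : ℤ → ℤ → ℕ → Set
x ≡ y [mod N ] = + N ∣ (x - y)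

-- Coefficient lists, constant term first; trailing zeros are allowed.

ℤ[x] : Set
ℤ[x] = List ℤ

eval : ℤ[x] → ℤ → ℤ
eval []       x = 0ℤ
eval (a ∷ as) x = a + x * eval as x

infixl 6 _⊕_
infixl 7 _⊗_

_⊕_ : ℤ[x] → ℤ[x] → ℤ[x]
[]       ⊕ bs       = bs
(a ∷ as) ⊕ []       = a ∷ as
(a ∷ as) ⊕ (b ∷ bs) = a + b ∷ as ⊕ bs

_⊗_ : ℤ[x] → ℤ[x] → ℤ[x]
[]       ⊗ bs = []
(a ∷ as) ⊗ bs = map (a *_) bs ⊕ (0ℤ ∷ as ⊗ bs)

compose : ℤ[x] → ℤ[x] → ℤ[x]
compose []       g = []
compose (a ∷ as) g = (a ∷ []) ⊕ g ⊗ compose as g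

iterateₚ : ℕ → ℤ[x] → ℤ[x]
iterateₚ zero    f = 0ℤ ∷ 1ℤ ∷ []
iterateₚ (suc k) f = compose f (iterateₚ k f)

weighted : ℕ → List ℤ → List ℤ
weighted i []       = []
weighted i (a ∷ as) = + i * a ∷ weighted (suc i) as

derivative : ℤ[x] → ℤ[x]
derivative []       = []
derivative (a ∷ as) = weighted 1 as

-- A cycle (x₁, …, x_k) of f acting on ℤ/pⁿ, with k = suc last ≥ 1 and
-- x₁ = point zero.

record Cycle (f : ℤ[x]) (p n : ℕ) : Set where
  field
    last     : ℕ
    point    : Fin (suc last) → ℤ
    distinct : Injective _≡_ (_≡_[mod p ℕ.^ n ]) point
    steps    : ∀ (i : Fin last) →
               eval f (point (inject₁ i)) ≡ point (suc i) [mod p ℕ.^ n ]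
    closes   : eval f (point (fromℕ last)) ≡ point zero [mod p ℕ.^ n ]

  len : ℕ
  len = suc last

open Cycle public

-- Equality of cycles, that is, up to rotation and choice of representatives.
-- As f determines the successor of each class, this amounts to consisting of
-- the same classes.

_≋_ : ∀ {f p n} → Cycle f p n → Cycle f p n → Set
_≋_ {p = p} {n} σ τ =
    (∀ i → ∃ λ j → point σ i ≡ point τ j [mod p ℕ.^ n ])
  × (∀ j → ∃ λ i → point τ j ≡ point σ i [mod p ℕ.^ n ])

_IsLiftOf_ : ∀ {f p n} → Cycle f p (suc n) → Cycle f p n → Set
_IsLiftOf_ {p = p} {n} τ σ = ∀ j → ∃ λ i → point τ j ≡ point σ i [mod p ℕ.^ n ]

data _IsSuccessiveLiftOf_ {f p n} :
     ∀ {m} → Cycle f p m → Cycle f p n → Set where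
  lift      : ∀ {σ : Cycle f p n} {τ : Cycle f p (suc n)} →
              τ IsLiftOf σ → τ IsSuccessiveLiftOf σ
  next-lift : ∀ {m} {σ : Cycle f p n}
              {ρ : Cycle f p m} {τ : Cycle f p (suc m)} →
              ρ IsSuccessiveLiftOf σ → τ IsLiftOf ρ → τ IsSuccessiveLiftOf σ

module _ {f : ℤ[x]} {p n : ℕ} (σ : Cycle f p n) where

  return : ℤ[x]
  return = iterateₚ (len σ) f

  multiplier : ℤ
  multiplier = eval (derivative return) (point σ zero)

  -- The division is exact, since σ is a cycle.

  displacement : .{{NonZero p}} → ℤ
  displacement = (eval return (point σ zero) - point σ zero) / (+ (p ℕ.^ n))
    where instance _ = ℕ.m^n≢0 p n

  Grows : .{{NonZero p}} → Set
  Grows = multiplier ≡ 1ℤ [mod p ] × ¬ (displacement ≡ 0ℤ [mod p ])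

{-# OPTIONS --safe #-}

-- Let g = f^k with g(x) = x + pⁿ b and g′(x) = 1 + p c. Since 2n ≥ n + 2, a first-order Taylor
-- expansion determines g on x + pⁿ ℤ modulo pⁿ⁺²: x + pⁿ s goes to x + pⁿ (b + (1 + p c) s),
-- so that gᵗ(x) ≡ x + pⁿ b (t + p c t(t-1)/2). Modulo pⁿ⁺¹ this reads x + pⁿ b t, whence
-- the points over the cycle form one cycle of length p k; and at t = p, as p is odd, the
-- correction p c p(p-1)/2 vanishes modulo p², so the new displacement is again b modulo p.

module Submission where

open import Defs
open import Data.Nat using (ℕ; NonZero; _≤_)
open import Data.Nat.Divisibility using (_∣_)
open import Data.Nat.Primality using (Prime)
open import Data.Product using (_×_; ∃!)
open import Relation.Nullary using (¬_)
open import Algebra.Bundles using (module AbelianGroup)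
open import Algebra.Properties.Group using (∙-cancelˡ)
open import Data.Empty using (⊥-elim)
open import Data.Fin using (Fin; zero; suc; toℕ; fromℕ; fromℕ<; inject₁)
import Data.Fin.Induction as Fin
import Data.Fin.Properties as Fin
open import Data.Integer using (ℤ; +_; -[1+_]; _+_; _-_; -_; _*_; 0ℤ; 1ℤ; ∣_∣)
import Data.Integer.DivMod as ℤ
import Data.Integer.Divisibility.Signed as Signed
import Data.Integer.Properties as ℤ
open import Data.Integer.Tactic.RingSolver using (solve-∀)
open import Data.List using ([]; _∷_; map)
open import Data.Nat using (zero; suc; z≤n; s≤s)
import Data.Nat as ℕ
open import Data.Nat.Coprimality using (Coprime; coprime-Bézout)
import Data.Nat.Divisibility as ℕ
import Data.Nat.DivMod as ℕ
open import Data.Nat.GCD using (module Bézout)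
open import Data.Nat.Primality
  using (euclidsLemma; prime[2]; ¬prime[1]; prime⇒irreducible; prime⇒nonZero)
import Data.Nat.Properties as ℕ
import Data.Nat.Tactic.RingSolver as ℕ
open import Data.Product using (∃; _,_; proj₁; proj₂)
open import Data.Sum using (_⊎_; inj₁; inj₂)
open import Relation.Binary.PropositionalEquality
  using (_≡_; refl; sym; trans; cong; cong₂; subst; subst₂; module ≡-Reasoning)

-- Congruences

infix 4 _≃_[_]
infix 5 _because_

-- Congruence with its quotient as data: matching the equation with `refl` eliminates x, after which
-- the ring solver checks each rule against an explicit quotient. The modulus is an integer, so it
-- can be a product or a Taylor increment.
record _≃_[_] (x y M : ℤ) : Set where
  constructor _because_
  field
    quotient : ℤ
    equality : x ≡ y + M * quotient

module _ {M : ℤ} where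

  ≃-reflexive : ∀ {x y} → x ≡ y → x ≃ y [ M ]
  ≃-reflexive {x} refl = 0ℤ because lemma x M
    where
    lemma : ∀ x M → x ≡ x + M * 0ℤ
    lemma = solve-∀

  ≃-refl : ∀ {x} → x ≃ x [ M ]
  ≃-refl = ≃-reflexive refl

  ≃-sym : ∀ {x y} → x ≃ y [ M ] → y ≃ x [ M ]
  ≃-sym {y = y} (r because refl) = (- r) because lemma y M r
    where
    lemma : ∀ y M r → y ≡ y + M * r + M * (- r)
    lemma = solve-∀

  ≃-trans : ∀ {x y z} → x ≃ y [ M ] → y ≃ z [ M ] → x ≃ z [ M ]
  ≃-trans {z = z} (r because refl) (s because refl) = (s + r) because lemma z M s r
    where
    lemma : ∀ z M s r → z + M * s + M * r ≡ z + M * (s + r)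
    lemma = solve-∀

  *-cong : ∀ {x x′ y y′} → x ≃ x′ [ M ] → y ≃ y′ [ M ] → x * y ≃ x′ * y′ [ M ]
  *-cong {x′ = x} {y′ = y} (r because refl) (s because refl) =
    (x * s + r * y + r * (M * s)) because lemma x y M r s
    where
    lemma : ∀ x y M r s →
      (x + M * r) * (y + M * s) ≡ x * y + M * (x * s + r * y + r * (M * s))
    lemma = solve-∀

  ≃-weaken : ∀ {x y} e → x ≃ y [ M * e ] → x ≃ y [ M ]
  ≃-weaken {y = y} e (r because refl) = (e * r) because cong (_+_ y) (ℤ.*-assoc M e r)

-- Passes from points of the progression x + M ℤ to their coordinates; M will be a Taylor increment
-- or a power of p.
≃-cancel : ∀ M .{{_ : ℕ.NonZero ∣ M ∣}} {N} x {y z} →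
           x + M * y ≃ x + M * z [ M * N ] → y ≃ z [ N ]
≃-cancel M {N} x {y} {z} (r because eq) = r because
  ℤ.*-cancelˡ-≡ M y (z + N * r)
    (∙-cancelˡ (AbelianGroup.group ℤ.+-0-abelianGroup) x _ _ (trans eq (lemma x M N z r)))
  where
  lemma : ∀ x M N z r → x + M * z + M * N * r ≡ x + M * (z + N * r)
  lemma = solve-∀

≃⇒mod : ∀ {x y N} → x ≃ y [ + N ] → x ≡ y [mod N ]
≃⇒mod {y = y} {N} (r because refl) = Signed.∣⇒∣ᵤ (Signed.divides r (lemma y (+ N) r))
  where
  lemma : ∀ y M r → y + M * r + - y ≡ r * M
  lemma = solve-∀

mod⇒≃ : ∀ {x y N} → x ≡ y [mod N ] → x ≃ y [ + N ]
mod⇒≃ {x} {y} {N} d with Signed.divides r eq ← Signed.∣ᵤ⇒∣ {+ N} {x - y} d =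
  r because trans (lemma x y) (cong (_+_ y) (trans eq (ℤ.*-comm r (+ N))))
  where
  lemma : ∀ x y → x ≡ y + (x + - y)
  lemma = solve-∀

≃0⇒∣ : ∀ {x N} → x ≃ 0ℤ [ + N ] → N ∣ ∣ x ∣
≃0⇒∣ {x} {N} c = subst (λ z → N ∣ ∣ z ∣) (ℤ.+-identityʳ x) (≃⇒mod c)

∣⇒≃0 : ∀ {x N} → N ∣ ∣ x ∣ → x ≃ 0ℤ [ + N ]
∣⇒≃0 {x} {N} d = mod⇒≃ (subst (λ z → N ∣ ∣ z ∣) (sym (ℤ.+-identityʳ x)) d)

≃-cancel-prime : ∀ {p} → Prime p → ∀ {u x y} → ¬ (u ≃ 0ℤ [ + p ]) →
                 u * x ≃ u * y [ + p ] → x ≃ y [ + p ]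
≃-cancel-prime {p} pr {u} {x} {y} u≄0 c
  with euclidsLemma ∣ u ∣ ∣ x - y ∣ pr
         (subst (p ∣_) (trans (cong ∣_∣ (lemma u x y)) (ℤ.abs-* u (x - y))) (≃⇒mod c))
  where
  lemma : ∀ u x y → u * x + - (u * y) ≡ u * (x + - y)
  lemma = solve-∀
... | inj₁ d = ⊥-elim (u≄0 (∣⇒≃0 d))
... | inj₂ d = mod⇒≃ d

-- Polynomials

eval-⊕ : ∀ g h x → eval (g ⊕ h) x ≡ eval g x + eval h x
eval-⊕ []       h        x = sym (ℤ.+-identityˡ _)
eval-⊕ (a ∷ as) []       x = sym (ℤ.+-identityʳ _)
eval-⊕ (a ∷ as) (b ∷ bs) x rewrite eval-⊕ as bs x = lemma a b x (eval as x) (eval bs x)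
  where
  lemma : ∀ a b x A B → a + b + x * (A + B) ≡ a + x * A + (b + x * B)
  lemma = solve-∀

eval-scale : ∀ c h x → eval (map (c *_) h) x ≡ c * eval h x
eval-scale c []       x = sym (ℤ.*-zeroʳ c)
eval-scale c (a ∷ as) x rewrite eval-scale c as x = lemma c a x (eval as x)
  where
  lemma : ∀ c a x A → c * a + x * (c * A) ≡ c * (a + x * A)
  lemma = solve-∀

eval-⊗ : ∀ g h x → eval (g ⊗ h) x ≡ eval g x * eval h x
eval-⊗ []       h x = refl
eval-⊗ (a ∷ as) h x
  rewrite eval-⊕ (map (a *_) h) (0ℤ ∷ as ⊗ h) x | eval-scale a h x | eval-⊗ as h x
  = lemma a x (eval as x) (eval h x)
  where
  lemma : ∀ a x A H → a * H + (0ℤ + x * (A * H)) ≡ (a + x * A) * H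
  lemma = solve-∀

eval-compose : ∀ g h x → eval (compose g h) x ≡ eval g (eval h x)
eval-compose []       h x = refl
eval-compose (a ∷ as) h x
  rewrite eval-⊕ (a ∷ []) (h ⊗ compose as h) x | eval-⊗ h (compose as h) x
        | eval-compose as h x
  = lemma a x (eval h x * eval as (eval h x))
  where
  lemma : ∀ a x z → a + x * 0ℤ + z ≡ a + z
  lemma = solve-∀

eval-weighted-suc : ∀ i h x → eval (weighted (suc i) h) x ≡ eval (weighted i h) x + eval h x
eval-weighted-suc i []       x = refl
eval-weighted-suc i (a ∷ as) x rewrite eval-weighted-suc (suc i) as x =
  lemma (+ i) a x (eval (weighted (suc i) as) x) (eval as x)
  where
  lemma : ∀ i a x W A → (1ℤ + i) * a + x * (W + A) ≡ i * a + x * W + (a + x * A)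
  lemma = solve-∀

-- Raising every weight by one adds the value of the polynomial once, so the weights obey the
-- product rule for a + x A. This is the recursion on which `taylor` runs.
eval-derivative-∷ : ∀ a as x →
  eval (derivative (a ∷ as)) x ≡ eval as x + x * eval (derivative as) x
eval-derivative-∷ a []       x = lemma x
  where
  lemma : ∀ x → 0ℤ ≡ 0ℤ + x * 0ℤ
  lemma = solve-∀
eval-derivative-∷ a (b ∷ bs) x rewrite eval-weighted-suc 0 (b ∷ bs) x =
  lemma b x (eval (weighted 1 bs) x) (b + x * eval bs x)
  where
  lemma : ∀ b x W B → 0ℤ * b + x * W + B ≡ B + x * W
  lemma = solve-∀

-- The remainder is only claimed to be a multiple of y * y, so it stays integral and no factorials
-- appear.
taylor : ∀ h x y → ∃ λ q →
  eval h (x + y) ≡ eval h x + y * (eval (derivative h) x + y * q)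
taylor []       x y = 0ℤ , lemma y
  where
  lemma : ∀ y → 0ℤ ≡ 0ℤ + y * (0ℤ + y * 0ℤ)
  lemma = solve-∀
taylor (a ∷ as) x y with q , eq ← taylor as x y
  rewrite eq | eval-derivative-∷ a as x
  -- Unification with `lemma` fixes the new remainder as A′ + (x + y) q.
  = _ , lemma a x y (eval as x) (eval (derivative as) x) q
  where
  lemma : ∀ a x y A A′ q →
    a + (x + y) * (A + y * (A′ + y * q)) ≡
    a + x * A + y * (A + x * A′ + y * (A′ + (x + y) * q))
  lemma = solve-∀

eval-cong : ∀ h {M x y} → x ≃ y [ M ] → eval h x ≃ eval h y [ M ]
eval-cong h {M} {y = y} (r because refl) with q , eq ← taylor h y (M * r) =
  _ because trans eq (cong (_+_ (eval h y)) (ℤ.*-assoc M r _))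

-- Comparing first-order terms of Taylor expansions with increment M makes a
-- product rule for _⊗_ superfluous.

chain-rule : ∀ h g₁ g₂ → (∀ x → eval h x ≡ eval g₁ (eval g₂ x)) →
  ∀ M .{{_ : ℕ.NonZero ∣ M ∣}} x →
  eval (derivative h) x ≃
  eval (derivative g₁) (eval g₂ x) * eval (derivative g₂) x [ M ]
chain-rule h g₁ g₂ h≗g₁∘g₂ M x
  with q , eq ← taylor h x M
  with q₂ , eq₂ ← taylor g₂ x M
  with q₁ , eq₁ ← taylor g₁ (eval g₂ x) (M * (eval (derivative g₂) x + M * q₂))
  = ≃-trans (≃-sym (q because refl))
    (≃-trans (≃-cancel M (eval h x) (≃-reflexive key))
             (_ because expand M d₁ d₂ q₁ q₂))
  where
  h′ = eval (derivative h) x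
  d₂ = eval (derivative g₂) x
  d₁ = eval (derivative g₁) (eval g₂ x)
  key : eval h x + M * (h′ + M * q) ≡
        eval h x + M * ((d₂ + M * q₂) * (d₁ + M * (d₂ + M * q₂) * q₁))
  key = begin
    eval h x + M * (h′ + M * q)                ≡⟨ eq ⟨
    eval h (x + M)                             ≡⟨ h≗g₁∘g₂ (x + M) ⟩
    eval g₁ (eval g₂ (x + M))                  ≡⟨ cong (eval g₁) eq₂ ⟩
    eval g₁ (eval g₂ x + M * (d₂ + M * q₂))    ≡⟨ eq₁ ⟩
    eval g₁ (eval g₂ x) + M * (d₂ + M * q₂) * (d₁ + M * (d₂ + M * q₂) * q₁)
      ≡⟨ cong₂ _+_ (sym (h≗g₁∘g₂ x)) (ℤ.*-assoc M (d₂ + M * q₂) _) ⟩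
    eval h x + M * ((d₂ + M * q₂) * (d₁ + M * (d₂ + M * q₂) * q₁)) ∎
    where open ≡-Reasoning
  expand : ∀ M d₁ d₂ q₁ q₂ →
    (d₂ + M * q₂) * (d₁ + M * (d₂ + M * q₂) * q₁) ≡
    d₁ * d₂ + M * (d₂ * ((d₂ + M * q₂) * q₁) + q₂ * (d₁ + M * (d₂ + M * q₂) * q₁))
  expand = solve-∀

-- Arithmetic modulo an odd prime

∤⇒coprime : ∀ {p m} → Prime p → ¬ (p ∣ m) → Coprime m p
∤⇒coprime pr p∤m (d∣m , d∣p) with prime⇒irreducible pr d∣p
... | inj₁ d≡1  = d≡1
... | inj₂ refl = ⊥-elim (p∤m d∣m)

abs-or-neg : ∀ b → b ≡ + ∣ b ∣ ⊎ b ≡ - + ∣ b ∣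
abs-or-neg (+ n)    = inj₁ refl
abs-or-neg -[1+ n ] = inj₂ refl

natural-inverse : ∀ {p m} → Prime p → ¬ (p ∣ m) → ∃ λ c → + m * c ≃ 1ℤ [ + p ]
natural-inverse {p} {m} pr p∤m with coprime-Bézout (∤⇒coprime pr p∤m)
... | Bézout.+- x y eq = + x , + y because (begin
    + m * + x        ≡⟨ ℤ.*-comm (+ m) (+ x) ⟩
    + x * + m        ≡⟨ ℤ.pos-* x m ⟨
    + (x ℕ.* m)      ≡⟨ cong +_ eq ⟨
    1ℤ + + (y ℕ.* p) ≡⟨ cong (_+_ 1ℤ) (trans (ℤ.pos-* y p) (ℤ.*-comm (+ y) (+ p))) ⟩
    1ℤ + + p * + y   ∎)
    where open ≡-Reasoning
-- Here 1 + x m = y p, so the inverse of m is - x.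
... | Bézout.-+ x y eq = - + x , (- + y) because (begin
    + m * - + x                 ≡⟨ lemma₁ (+ m) (+ x) ⟩
    1ℤ + - (1ℤ + + x * + m)     ≡⟨ cong (λ z → 1ℤ + - (1ℤ + z)) (ℤ.pos-* x m) ⟨
    1ℤ + - (+ (1 ℕ.+ x ℕ.* m))  ≡⟨ cong (λ z → 1ℤ + - (+ z)) eq ⟩
    1ℤ + - (+ (y ℕ.* p))        ≡⟨ cong (λ z → 1ℤ + - z) (ℤ.pos-* y p) ⟩
    1ℤ + - (+ y * + p)          ≡⟨ lemma₂ (+ y) (+ p) ⟩
    1ℤ + + p * - + y            ∎)
    where
    open ≡-Reasoning
    lemma₁ : ∀ m x → m * - x ≡ 1ℤ + - (1ℤ + x * m)
    lemma₁ = solve-∀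
    lemma₂ : ∀ y p → 1ℤ + - (y * p) ≡ 1ℤ + p * - y
    lemma₂ = solve-∀

inverse : ∀ {p} → Prime p → ∀ {b} → ¬ (b ≃ 0ℤ [ + p ]) → ∃ λ c → b * c ≃ 1ℤ [ + p ]
inverse {p} pr {b} b≄0 with natural-inverse pr (λ d → b≄0 (∣⇒≃0 {b} d)) | abs-or-neg b
... | c , bc≃1 | inj₁ b≡ = c , subst (λ z → z * c ≃ 1ℤ [ + p ]) (sym b≡) bc≃1
... | c , bc≃1 | inj₂ b≡ = - c ,
  subst (_≃ 1ℤ [ + p ]) (trans (lemma (+ ∣ b ∣) c) (cong (_* - c) (sym b≡))) bc≃1
  where
  lemma : ∀ b c → b * c ≡ - b * - c
  lemma = solve-∀

natural-representative : ∀ p .{{_ : NonZero p}} s → ∃ λ t → + t ≃ s [ + p ]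
natural-representative p s =
  s ℤ.%ℕ p , ≃-sym ((s ℤ./ℕ p) because
    trans (ℤ.a≡a%ℕn+[a/ℕn]*n s p) (cong (_+_ (+ (s ℤ.%ℕ p))) (ℤ.*-comm (s ℤ./ℕ p) (+ p))))

-- The solution is taken in ℕ because it will count turns around a cycle.
solve-linear : ∀ {p} .{{_ : NonZero p}} → Prime p → ∀ {b} → ¬ (b ≃ 0ℤ [ + p ]) →
               ∀ s → ∃ λ t → b * + t ≃ s [ + p ]
solve-linear {p} pr {b} b≄0 s with inverse pr b≄0
... | c , bc≃1 with natural-representative p (c * s)
... | t , t≃cs = t ,
  ≃-trans (*-cong (≃-refl {x = b}) t≃cs)
    (subst₂ (_≃_[ + p ]) (ℤ.*-assoc b c s) (ℤ.*-identityˡ s) (*-cong bc≃1 (≃-refl {x = s})))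

-- The remainder is a multiple of N lying below N, so it vanishes. This evaluates the division in
-- `displacement`.
/-exact : ∀ N .{{_ : NonZero N}} b → (+ N * b) ℤ./ + N ≡ b
/-exact N b = ℤ.*-cancelʳ-≡ q b (+ N) (begin
  q * + N                ≡⟨ ℤ.+-identityˡ (q * + N) ⟨
  0ℤ + q * + N           ≡⟨ cong (λ r → + r + q * + N) r≡0 ⟨
  + r + q * + N          ≡⟨ division ⟨
  + N * b                ≡⟨ ℤ.*-comm (+ N) b ⟩
  b * + N                ∎)
  where
  open ≡-Reasoning
  q = (+ N * b) ℤ./ + N
  r = (+ N * b) ℤ.% + N
  division : + N * b ≡ + r + q * + N
  division = ℤ.a≡a%n+[a/n]*n (+ N * b) (+ N)
  isolate : ∀ r s → r ≡ r + s + - s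
  isolate = solve-∀
  collect : ∀ N b q → N * b + - (q * N) ≡ 0ℤ + N * (b + - q)
  collect = solve-∀
  r≃0 : + r ≃ 0ℤ [ + N ]
  r≃0 = (b + - q) because trans (isolate (+ r) (q * + N))
    (trans (cong (_+ (- (q * + N))) (sym division)) (collect (+ N) b q))
  r≡0 : r ≡ 0
  r≡0 = trans (sym (ℕ.m<n⇒m%n≡m (ℤ.n%d<d (+ N * b) (+ N)))) (ℕ.n∣m⇒m%n≡0 r N (≃0⇒∣ r≃0))

-- The binomial coefficient t (t - 1) / 2, as the sum 0 + 1 + ⋯ + (t - 1) that accumulates in
-- `it-growing-mod²`.
triangle : ℕ → ℕ
triangle zero    = 0
triangle (suc t) = triangle t ℕ.+ t

triangle-double : ∀ t → t ℕ.+ 2 ℕ.* triangle t ≡ t ℕ.* t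
triangle-double zero    = refl
triangle-double (suc t) = trans (lemma₁ t (triangle t))
  (trans (cong (λ z → z ℕ.+ (t ℕ.+ t) ℕ.+ 1) (triangle-double t)) (lemma₂ t))
  where
  lemma₁ : ∀ t r → suc t ℕ.+ 2 ℕ.* (r ℕ.+ t) ≡ (t ℕ.+ 2 ℕ.* r) ℕ.+ (t ℕ.+ t) ℕ.+ 1
  lemma₁ = ℕ.solve-∀
  lemma₂ : ∀ t → t ℕ.* t ℕ.+ (t ℕ.+ t) ℕ.+ 1 ≡ suc t ℕ.* suc t
  lemma₂ = ℕ.solve-∀

-- By `triangle-double`, p divides p * p - p, which is twice `triangle p`; oddness excludes p ∣ 2.
odd-prime∣triangle : ∀ {p} → Prime p → ¬ (2 ∣ p) → p ∣ triangle p
odd-prime∣triangle {p} pr 2∤p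
  with euclidsLemma 2 (triangle p) pr
         (ℕ.∣m+n∣m⇒∣n (subst (p ∣_) (sym (triangle-double p)) (ℕ.m∣m*n p)) ℕ.∣-refl)
... | inj₂ d = d
... | inj₁ p∣2 with prime⇒irreducible prime[2] p∣2
... | inj₂ refl = ⊥-elim (2∤p ℕ.∣-refl)
... | inj₁ refl = ⊥-elim (¬prime[1] pr)

-- Iterates

module Dynamics (f : ℤ[x]) where

  it : ℕ → ℤ → ℤ
  it k x = eval (iterateₚ k f) x

  D : ℕ → ℤ → ℤ
  D k x = eval (derivative (iterateₚ k f)) x

  it-zero : ∀ x → it 0 x ≡ x
  it-zero = lemma
    where
    lemma : ∀ x → 0ℤ + x * (1ℤ + x * 0ℤ) ≡ x
    lemma = solve-∀

  it-suc : ∀ k x → it (suc k) x ≡ eval f (it k x)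
  it-suc k = eval-compose f (iterateₚ k f)

  it-+ : ∀ k m x → it (k ℕ.+ m) x ≡ it k (it m x)
  it-+ zero    m x = sym (it-zero (it m x))
  it-+ (suc k) m x = trans (it-suc (k ℕ.+ m) x)
    (trans (cong (eval f) (it-+ k m x)) (sym (it-suc k (it m x))))

  it-comm : ∀ k m x → it k (it m x) ≡ it m (it k x)
  it-comm k m x = trans (sym (it-+ k m x))
    (trans (cong (λ j → it j x) (ℕ.+-comm k m)) (it-+ m k x))

  it-cong : ∀ k {M x y} → x ≃ y [ M ] → it k x ≃ it k y [ M ]
  it-cong k = eval-cong (iterateₚ k f)

  D-cong : ∀ k {M x y} → x ≃ y [ M ] → D k x ≃ D k y [ M ]
  D-cong k = eval-cong (derivative (iterateₚ k f))

  D-+ : ∀ k m x M .{{_ : ℕ.NonZero ∣ M ∣}} → D (k ℕ.+ m) x ≃ D k (it m x) * D m x [ M ]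
  D-+ k m x M = chain-rule (iterateₚ (k ℕ.+ m) f) (iterateₚ k f) (iterateₚ m f) (it-+ k m) M x

  it-multiple : ∀ {M} k {x} → it k x ≃ x [ M ] → ∀ t → it (t ℕ.* k) x ≃ x [ M ]
  it-multiple k {x} c zero    = ≃-reflexive (it-zero x)
  it-multiple k {x} c (suc t) =
    ≃-trans (≃-reflexive (it-+ k (t ℕ.* k) x)) (≃-trans (it-cong k (it-multiple k c t)) c)

  -- By the chain rule the derivative over t turns is a product of t factors, each taken at a point
  -- congruent to x.
  D-multiple : ∀ {M} .{{_ : ℕ.NonZero ∣ M ∣}} k {x} →
               it k x ≃ x [ M ] → D k x ≃ 1ℤ [ M ] → ∀ t → D (t ℕ.* k) x ≃ 1ℤ [ M ]
  D-multiple {M} k {x} c d zero    = ≃-reflexive (lemma x)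
    where
    lemma : ∀ x → 1ℤ * 1ℤ + x * 0ℤ ≡ 1ℤ
    lemma = solve-∀
  D-multiple {M} k {x} c d (suc t) = ≃-trans (D-+ k (t ℕ.* k) x M)
    (*-cong (≃-trans (D-cong k (it-multiple k c t)) d) (D-multiple k c d t))

  -- Only the minimality half of being the exact period; that x does return after k steps is a
  -- separate hypothesis wherever it matters.
  IsPeriod : ℤ → ℕ → ℤ → Set
  IsPeriod M k x = ∀ j → it j x ≃ x [ M ] → k ∣ j

  -- Cycles as orbits

  module Orbit {p n : ℕ} (σ : Cycle f p n) where

    M : ℤ
    M = + (p ℕ.^ n)

    start : ℤ
    start = point σ zero

    point≃it : ∀ i → point σ i ≃ it (toℕ i) start [ M ]
    point≃it = Fin.<-weakInduction (λ i → point σ i ≃ it (toℕ i) start [ M ])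
      (≃-reflexive (sym (it-zero start)))
      (λ i c → ≃-trans (≃-sym (mod⇒≃ (steps σ i)))
        (≃-trans (eval-cong f c)
        (≃-reflexive (trans (cong (λ j → eval f (it j start)) (Fin.toℕ-inject₁ i))
                            (sym (it-suc (toℕ i) start))))))

    it-len : it (len σ) start ≃ start [ M ]
    it-len = ≃-trans (≃-reflexive (trans (it-suc (last σ) start)
        (cong (λ j → eval f (it j start)) (sym (Fin.toℕ-fromℕ (last σ))))))
      (≃-trans (eval-cong f (≃-sym (point≃it (fromℕ (last σ))))) (mod⇒≃ (closes σ)))

    index : ℕ → Fin (len σ)
    index j = fromℕ< (ℕ.m%n<n j (len σ))

    it≃point : ∀ j → it j start ≃ point σ (index j) [ M ]
    it≃point j =
      ≃-trans (≃-reflexive (trans (cong (λ i → it i start) (ℕ.m≡m%n+[m/n]*n j (len σ)))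
                                  (it-+ r (j ℕ./ len σ ℕ.* len σ) start)))
      (≃-trans (it-cong r (it-multiple (len σ) it-len (j ℕ./ len σ)))
      (≃-trans (≃-reflexive (cong (λ i → it i start) (sym (Fin.toℕ-fromℕ< (ℕ.m%n<n j (len σ))))))
               (≃-sym (point≃it (index j)))))
      where r = j ℕ.% len σ

    -- If `start` returns after j steps, the point at position j mod k is congruent to the one at
    -- position 0, and distinctness makes the remainder zero.
    len-isPeriod : IsPeriod M (len σ) start
    len-isPeriod j c = ℕ.m%n≡0⇒n∣m j (len σ)
      (trans (sym (Fin.toℕ-fromℕ< (ℕ.m%n<n j (len σ))))
             (cong toℕ (distinct σ {index j} {zero} (≃⇒mod (≃-trans (≃-sym (it≃point j)) c)))))

    -- Complete the turn back to `start`, then walk on to i′.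
    reach : ∀ i i′ → ∃ λ j → it j (point σ i) ≃ point σ i′ [ M ]
    reach i i′ = toℕ i′ ℕ.+ d ,
      ≃-trans (≃-reflexive (it-+ (toℕ i′) d (point σ i)))
      (≃-trans (it-cong (toℕ i′)
        (≃-trans (it-cong d (point≃it i))
        (≃-trans (≃-reflexive (trans (sym (it-+ d (toℕ i) start))
                   (cong (λ j → it j start) (ℕ.m∸n+n≡m (ℕ.<⇒≤ (Fin.toℕ<n i))))))
                 it-len)))
      (≃-sym (point≃it i′)))
      where d = len σ ℕ.∸ toℕ i

  -- Applying k - i further steps to both sides brings the left one back to x, so k divides (k - i)
  -- + j = k + (j - i), hence also j - i, which is less than k.
  it-injective-≤ : ∀ {M} k {x} → it k x ≃ x [ M ] → IsPeriod M k x →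
                   ∀ {i j} → i ≤ j → j ℕ.< k → it i x ≃ it j x [ M ] → i ≡ j
  it-injective-≤ {M} k@(suc _) {x} c per {i} {j} i≤j j<k it-i≃it-j =
    ℕ.≤-antisym i≤j (ℕ.m∸n≡0⇒m≤n j∸i≡0)
    where
    i≤k : i ≤ k
    i≤k = ℕ.≤-trans i≤j (ℕ.<⇒≤ j<k)
    d = k ℕ.∸ i
    k∣d+j : k ∣ d ℕ.+ j
    k∣d+j = per (d ℕ.+ j)
      (≃-trans (≃-reflexive (it-+ d j x))
      (≃-trans (it-cong d (≃-sym it-i≃it-j))
      (≃-trans (≃-reflexive (trans (sym (it-+ d i x)) (cong (λ m → it m x) (ℕ.m∸n+n≡m i≤k)))) c)))
    k∣j∸i : k ∣ j ℕ.∸ i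
    k∣j∸i = ℕ.∣m+n∣m⇒∣n
      (subst (k ∣_) (trans (sym (ℕ.+-∸-comm j i≤k)) (ℕ.+-∸-assoc k i≤j)) k∣d+j) ℕ.∣-refl
    j∸i≡0 : j ℕ.∸ i ≡ 0
    j∸i≡0 = trans (sym (ℕ.m<n⇒m%n≡m (ℕ.≤-<-trans (ℕ.m∸n≤m j i) j<k)))
                  (ℕ.n∣m⇒m%n≡0 (j ℕ.∸ i) k k∣j∸i)

  it-injective : ∀ {M} k {x} → it k x ≃ x [ M ] → IsPeriod M k x →
                 ∀ {i j} → i ℕ.< k → j ℕ.< k → it i x ≃ it j x [ M ] → i ≡ j
  it-injective k c per {i} {j} i<k j<k e with ℕ.≤-total i j
  ... | inj₁ i≤j = it-injective-≤ k c per i≤j j<k e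
  ... | inj₂ j≤i = sym (it-injective-≤ k c per j≤i i<k (≃-sym e))

  -- The points are also returned as an equation, since the cycle does not compute when k is a
  -- product such as `p ℕ.* k`.
  orbit-cycle : ∀ {p n} k .{{_ : NonZero k}} {x} → it k x ≃ x [ + (p ℕ.^ n) ] →
                IsPeriod (+ (p ℕ.^ n)) k x →
                ∃ λ (τ : Cycle f p n) → ∀ j → point τ j ≡ it (toℕ j) x
  orbit-cycle k@(suc l) {x} c per = record
    { last     = l
    ; point    = λ i → it (toℕ i) x
    ; distinct = λ {i} {j} e →
        Fin.toℕ-injective (it-injective k c per (Fin.toℕ<n i) (Fin.toℕ<n j) (mod⇒≃ e))
    ; steps    = λ i → ≃⇒mod (≃-reflexive
        (trans (sym (it-suc (toℕ (inject₁ i)) x)) (cong (λ j → it (suc j) x) (Fin.toℕ-inject₁ i))))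
    ; closes   = ≃⇒mod (≃-trans (≃-reflexive
        (trans (sym (it-suc (toℕ (fromℕ l)) x)) (cong (λ j → it (suc j) x) (Fin.toℕ-fromℕ l))))
        (≃-trans c (≃-reflexive (sym (it-zero x)))))
    } , λ j → refl

  -- Growth at a point, for an odd prime

  module OddPrime {p : ℕ} (pr : Prime p) (2∤p : ¬ (2 ∣ p)) where

    instance
      p≢0 : NonZero p
      p≢0 = prime⇒nonZero pr

    P : ℤ
    P = + p

    Q : ℕ → ℤ
    Q n = + (p ℕ.^ n)

    Q-suc : ∀ n → Q (suc n) ≡ P * Q n
    Q-suc n = ℤ.pos-* p (p ℕ.^ n)

    Q-suc² : ∀ m → Q (2 ℕ.+ m) ≡ P * (P * Q m)
    Q-suc² m = trans (Q-suc (suc m)) (cong (P *_) (Q-suc m))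

    Q-suc′ : ∀ n → Q (suc n) ≡ Q n * P
    Q-suc′ n = trans (Q-suc n) (ℤ.*-comm P (Q n))

    Q-weaken : ∀ n {x y} → x ≃ y [ Q (suc n) ] → x ≃ y [ Q n ]
    Q-weaken n {x} {y} c =
      ≃-weaken P (subst (λ M → x ≃ y [ M ]) (Q-suc′ n) c)

    Q⇒P : ∀ n {x y} → x ≃ y [ Q (suc n) ] → x ≃ y [ P ]
    Q⇒P n {x} {y} c = ≃-weaken (Q n) (subst (λ M → x ≃ y [ M ]) (Q-suc n) c)

    1≄0 : ¬ (1ℤ ≃ 0ℤ [ P ])
    1≄0 c with refl ← ℕ.∣1⇒≡1 (≃0⇒∣ c) = ¬prime[1] pr

    -- The orbit form of growth: x lies on a cycle of f modulo pⁿ whose length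
    -- divides k, with b as displacement and D k x as multiplier.

    record GrowsAt (k n : ℕ) (x : ℤ) : Set where
      field
        b            : ℤ
        displaces    : it k x ≡ x + Q n * b
        b≄0          : ¬ (b ≃ 0ℤ [ P ])
        multiplier≃1 : D k x ≃ 1ℤ [ P ]

      returns : it k x ≃ x [ Q n ]
      returns = b because displaces

    open GrowsAt

    -- With Q the modulus, moving x by Q t changes the difference of `it k x` and x by Q t (D k x -
    -- 1) plus a multiple of Q * Q. Both are multiples of P Q, as the exponent is positive, so b is
    -- unchanged modulo p.
    growsAt-cong : ∀ {k n x y} → y ≃ x [ Q (suc n) ] →
                   GrowsAt k (suc n) x → GrowsAt k (suc n) y
    growsAt-cong {k} {n} {x} y≃x@(t because refl) G
      with c because D≡ ← multiplier≃1 G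
      with q , eq ← taylor (iterateₚ k f) x (Q (suc n) * t)
      = record
      { b            = b G + P * z
      ; displaces    = begin
          it k (x + Q (suc n) * t)                               ≡⟨ eq ⟩
          it k x + Q (suc n) * t * (D k x + Q (suc n) * t * q)
            ≡⟨ cong₂ (λ u v → u + Q (suc n) * t * (v + Q (suc n) * t * q)) (displaces G) D≡ ⟩
          x + Q (suc n) * b G + Q (suc n) * t * (1ℤ + P * c + Q (suc n) * t * q)
            ≡⟨ subst (λ M → x + M * b G + M * t * (1ℤ + P * c + M * t * q) ≡ x + M * t + M * (b G + P * z))
                 (sym (Q-suc n)) (lemma x (b G) P (Q n) t c q) ⟩
          x + Q (suc n) * t + Q (suc n) * (b G + P * z)          ∎
      ; b≄0          = λ b≃0 → b≄0 G (≃-trans (≃-sym (z because refl)) b≃0)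
      ; multiplier≃1 = ≃-trans (D-cong k (Q⇒P n y≃x)) (multiplier≃1 G)
      }
      where
      open ≡-Reasoning
      z = t * (c + Q n * t * q)
      lemma : ∀ x b P Q t c q →
        x + P * Q * b + P * Q * t * (1ℤ + P * c + P * Q * t * q) ≡
        x + P * Q * t + P * Q * (b + P * (t * (c + Q * t * q)))
      lemma = solve-∀

    -- As f commutes with its iterates, one step multiplies b by u = f′(x) modulo p. This u is a
    -- unit, being a factor of the multiplier.
    growsAt-step : ∀ {k n x} → GrowsAt (suc k) (suc n) x → GrowsAt (suc k) (suc n) (it 1 x)
    growsAt-step {k} {n} {x} G
      with q , eq ← taylor (iterateₚ 1 f) x (Q (suc n) * b G)
      = record
      { b            = u * b G + P * z
      ; displaces    = begin
          it (suc k) (it 1 x)           ≡⟨ it-comm (suc k) 1 x ⟩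
          it 1 (it (suc k) x)           ≡⟨ cong (it 1) (displaces G) ⟩
          it 1 (x + Q (suc n) * b G)    ≡⟨ eq ⟩
          it 1 x + Q (suc n) * b G * (u + Q (suc n) * b G * q)
            ≡⟨ subst (λ M → it 1 x + M * b G * (u + M * b G * q) ≡ it 1 x + M * (u * b G + P * z))
                 (sym (Q-suc n)) (lemma (it 1 x) (b G) P (Q n) u q) ⟩
          it 1 x + Q (suc n) * (u * b G + P * z) ∎
      ; b≄0          = λ ub≃0 → b≄0 G (≃-cancel-prime pr u≄0
          (≃-trans (≃-trans (≃-sym (z because refl)) ub≃0) (≃-reflexive (sym (ℤ.*-zeroʳ u)))))
      ; multiplier≃1 = ≃-cancel-prime pr u≄0 u*D≃u*1
      }
      where
      open ≡-Reasoning
      u = D 1 x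
      z = Q n * b G * b G * q
      lemma : ∀ y b P Q u q →
        y + P * Q * b * (u + P * Q * b * q) ≡ y + P * Q * (u * b + P * (Q * b * b * q))
      lemma = solve-∀
      -- The chain rule splits off the first step, so u ≃ 0 would make the multiplier 0 instead of
      -- 1.
      u≄0 : ¬ (u ≃ 0ℤ [ P ])
      u≄0 u≃0 = 1≄0 (≃-trans (≃-sym (multiplier≃1 G))
        (≃-trans (≃-reflexive (cong (λ j → D j x) (ℕ.+-comm 1 k)))
        (≃-trans (D-+ k 1 x P)
        (≃-trans (*-cong (≃-refl {x = D k (it 1 x)}) u≃0)
                 (≃-reflexive (ℤ.*-zeroʳ (D k (it 1 x))))))))
      -- The derivative over k + 2 steps is factored twice: with the single step first, and with it
      -- last.
      u*D≃u*1 : u * D (suc k) (it 1 x) ≃ u * 1ℤ [ P ]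
      u*D≃u*1 =
        ≃-trans (≃-reflexive (ℤ.*-comm u (D (suc k) (it 1 x))))
        (≃-trans (≃-sym (D-+ (suc k) 1 x P))
        (≃-trans (≃-reflexive (cong (λ j → D j x) (ℕ.+-comm (suc k) 1)))
        (≃-trans (D-+ 1 (suc k) x P)
                 (*-cong (D-cong 1 (Q⇒P n (returns G))) (multiplier≃1 G)))))

    growsAt-orbit : ∀ {k n x} → GrowsAt (suc k) (suc n) x →
                    ∀ i → GrowsAt (suc k) (suc n) (it i x)
    growsAt-orbit {k} {n} {x} G zero    = subst (GrowsAt (suc k) (suc n)) (sym (it-zero x)) G
    growsAt-orbit {k} {n} {x} G (suc i) =
      subst (GrowsAt (suc k) (suc n)) (sym (it-+ 1 i x)) (growsAt-step (growsAt-orbit G i))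

    -- The coefficient of Q is b (1 + (1 + p c) + ⋯ + (1 + p c)^(t-1)) reduced modulo p².

    it-growing-mod² : ∀ {k m x} (G : GrowsAt k (2 ℕ.+ m) x) →
      let c = _≃_[_].quotient (multiplier≃1 G) in
      ∀ t → it (t ℕ.* k) x ≃
            x + Q (2 ℕ.+ m) * (b G * (+ t + P * c * + triangle t)) [ Q (4 ℕ.+ m) ]
    it-growing-mod² {k} {m} {x} G zero =
      ≃-reflexive (trans (it-zero x) (lemma x (Q (2 ℕ.+ m)) (b G) P (_≃_[_].quotient (multiplier≃1 G))))
      where
      lemma : ∀ x Q b P c → x ≡ x + Q * (b * (0ℤ + P * c * 0ℤ))
      lemma = solve-∀
    it-growing-mod² {k} {m} {x} G (suc t)
      with q , eq ← taylor (iterateₚ k f) x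
             (Q (2 ℕ.+ m) * (b G * (+ t + P * _≃_[_].quotient (multiplier≃1 G) * + triangle t)))
      = ≃-trans (≃-reflexive (it-+ k (t ℕ.* k) x))
        (≃-trans (it-cong k (it-growing-mod² G t))
        (z because (begin
          it k (x + M * s)                         ≡⟨ eq ⟩
          it k x + M * s * (D k x + M * s * q)
            ≡⟨ cong₂ (λ u v → u + M * s * (v + M * s * q)) (displaces G)
                     (_≃_[_].equality (multiplier≃1 G)) ⟩
          x + M * b G + M * s * (1ℤ + P * c + M * s * q)
            ≡⟨ subst₂ (λ M N → x + M * b G + M * s * (1ℤ + P * c + M * s * q) ≡
                               x + M * (b G * (1ℤ + + t + P * c * (+ triangle t + + t))) + N * z)
                 (sym (Q-suc² m)) (sym (trans (Q-suc² (2 ℕ.+ m)) (cong (λ N → P * (P * N)) (Q-suc² m))))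
                 (lemma x (b G) P (Q m) (+ t) (+ triangle t) c q) ⟩
          x + M * (b G * (+ suc t + P * c * + triangle (suc t))) + Q (4 ℕ.+ m) * z ∎)))
      where
      open ≡-Reasoning
      M = Q (2 ℕ.+ m)
      c = _≃_[_].quotient (multiplier≃1 G)
      s = b G * (+ t + P * c * + triangle t)
      -- The first term comes from multiplying two corrections by p c, the second from the Taylor
      -- remainder. The latter is where n ≥ 2 enters: M * M = Q (4 + m) * Q m.
      z = c * c * b G * + triangle t + Q m * s * s * q
      lemma : ∀ x b P Q t r c q →
        x + P * (P * Q) * b + P * (P * Q) * (b * (t + P * c * r)) *
          (1ℤ + P * c + P * (P * Q) * (b * (t + P * c * r)) * q) ≡
        x + P * (P * Q) * (b * (1ℤ + t + P * c * (r + t))) +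
          P * (P * (P * (P * Q))) *
          (c * c * b * r + Q * (b * (t + P * c * r)) * (b * (t + P * c * r)) * q)
      lemma = solve-∀

    -- At t = p the main term b p supplies the extra factor p of the new modulus, while the
    -- correction p c `triangle p` is divisible by p * p; so b survives modulo p.
    growsAt-lift : ∀ {k m x} → GrowsAt k (2 ℕ.+ m) x → GrowsAt (p ℕ.* k) (3 ℕ.+ m) x
    growsAt-lift {k} {m} {x} G
      with ℕ.divides w eq ← odd-prime∣triangle pr 2∤p
      with r because drift ← it-growing-mod² G p
      = record
      { b            = b G + P * z
      ; displaces    = begin
          it (p ℕ.* k) x
            ≡⟨ drift ⟩
          x + M * (b G * (P + P * c * + triangle p)) + Q (4 ℕ.+ m) * r
            ≡⟨ cong₂ (λ T N → x + M * (b G * (P + P * c * T)) + N * r)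
                     (trans (cong +_ eq) (ℤ.pos-* w p)) (Q-suc² (2 ℕ.+ m)) ⟩
          x + M * (b G * (P + P * c * (+ w * P))) + P * (P * M) * r
            ≡⟨ lemma x M (b G) P c (+ w) r ⟩
          x + P * M * (b G + P * z)
            ≡⟨ cong (λ N → x + N * (b G + P * z)) (Q-suc (2 ℕ.+ m)) ⟨
          x + Q (3 ℕ.+ m) * (b G + P * z) ∎
      ; b≄0          = λ b≃0 → b≄0 G (≃-trans (≃-sym (z because refl)) b≃0)
      ; multiplier≃1 = D-multiple k (Q⇒P (suc m) (returns G)) (multiplier≃1 G) p
      }
      where
      open ≡-Reasoning
      M = Q (2 ℕ.+ m)
      c = _≃_[_].quotient (multiplier≃1 G)
      z = b G * c * + w + r
      lemma : ∀ x M b P c w r →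
        x + M * (b * (P + P * c * (w * P))) + P * (P * M) * r ≡
        x + P * M * (b + P * (b * c * w + r))
      lemma = solve-∀

    -- One power of p lower the quadratic correction disappears, and turns act as translation by b.
    -- The modulus is left as a product for `≃-cancel`.
    it-growing : ∀ {k m x} (G : GrowsAt k (2 ℕ.+ m) x) →
      ∀ t → it (t ℕ.* k) x ≃ x + Q (2 ℕ.+ m) * (b G * + t) [ Q (2 ℕ.+ m) * P ]
    it-growing {k} {m} {x} G t with r because drift ← it-growing-mod² G t =
      (b G * c * + triangle t + P * r) because
        trans drift (trans (cong (λ N → x + M * (b G * (+ t + P * c * + triangle t)) + N * r)
                                 (Q-suc² (2 ℕ.+ m)))
                           (lemma x M (b G) P c (+ t) (+ triangle t) r))
      where
      M = Q (2 ℕ.+ m)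
      c = _≃_[_].quotient (multiplier≃1 G)
      lemma : ∀ x M b P c t T r →
        x + M * (b * (t + P * c * T)) + P * (P * M) * r ≡
        x + M * (b * t) + M * P * (b * c * T + P * r)
      lemma = solve-∀

    -- A return modulo the higher power is one modulo the lower, so it takes t full turns; these
    -- translate by b t, and as p does not divide b, it must divide t.
    isPeriod-lift : ∀ {k m x} → GrowsAt k (2 ℕ.+ m) x →
                    IsPeriod (Q (2 ℕ.+ m)) k x → IsPeriod (Q (3 ℕ.+ m)) (p ℕ.* k) x
    isPeriod-lift {k} {m} {x} G per j c with per j (Q-weaken (2 ℕ.+ m) c)
    ... | ℕ.divides t refl = ℕ.*-monoˡ-∣ k (≃0⇒∣ (≃-cancel-prime pr (b≄0 G)
      (≃-cancel M x (≃-trans (≃-sym (it-growing G t))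
        (≃-trans (subst (λ N → it (t ℕ.* k) x ≃ x [ N ]) (Q-suc′ (2 ℕ.+ m)) c)
                 (≃-reflexive (lemma x M (b G))))))))
      where
      M = Q (2 ℕ.+ m)
      instance
        M≢0 : NonZero (p ℕ.^ (2 ℕ.+ m))
        M≢0 = ℕ.m^n≢0 p (2 ℕ.+ m)
      lemma : ∀ x M b → x ≡ x + M * (b * 0ℤ)
      lemma = solve-∀

    -- For y = x + M s it suffices to solve b t ≃ s modulo p, which is possible since b is a unit.
    reach-lift : ∀ {k m x y} → GrowsAt k (2 ℕ.+ m) x → y ≃ x [ Q (2 ℕ.+ m) ] →
                 ∃ λ t → it (t ℕ.* k) x ≃ y [ Q (3 ℕ.+ m) ]
    reach-lift {k} {m} {x} G (s because refl) with solve-linear pr (b≄0 G) s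
    ... | t , (r because eq) = t , subst (λ N → it (t ℕ.* k) x ≃ x + M * s [ N ]) (sym (Q-suc′ (2 ℕ.+ m)))
      (≃-trans (it-growing G t) (r because trans (cong (λ u → x + M * u) eq) (lemma x M s P r)))
      where
      M = Q (2 ℕ.+ m)
      lemma : ∀ x M s P r → x + M * (s + P * r) ≡ x + M * s + M * P * r
      lemma = solve-∀

    -- Growth of a cycle and growth at its first point

    displacement≡ : ∀ {n} (σ : Cycle f p n) {b} →
      it (len σ) (point σ zero) ≡ point σ zero + Q n * b → displacement σ ≡ b
    displacement≡ {n} σ {b} eq =
      trans (cong (ℤ._/ Q n) (trans (cong (_- point σ zero) eq) (lemma (point σ zero) (Q n * b))))
            (/-exact (p ℕ.^ n) b)
      where
      instance
        pⁿ≢0 : NonZero (p ℕ.^ n)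
        pⁿ≢0 = ℕ.m^n≢0 p n
      lemma : ∀ x y → x + y + - x ≡ y
      lemma = solve-∀

    growsAt⇒grows : ∀ {n} (σ : Cycle f p n) → GrowsAt (len σ) n (point σ zero) → Grows σ
    growsAt⇒grows σ G =
      ≃⇒mod {multiplier σ} {1ℤ} {p} (multiplier≃1 G) ,
      λ d → b≄0 G (subst (_≃ 0ℤ [ P ]) (displacement≡ σ {b G} (displaces G))
                         (mod⇒≃ {displacement σ} {0ℤ} {p} d))

    grows⇒growsAt : ∀ {n} (σ : Cycle f p n) → Grows σ → GrowsAt (len σ) n (point σ zero)
    grows⇒growsAt σ (a≡1 , b≢0) with b′ because eq ← Orbit.it-len σ = record
      { b            = b′
      ; displaces    = eq
      ; b≄0          = λ c → b≢0 (≃⇒mod {displacement σ} {0ℤ} {p}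
          (subst (_≃ 0ℤ [ P ]) (sym (displacement≡ σ {b′} eq)) c))
      ; multiplier≃1 = mod⇒≃ {multiplier σ} {1ℤ} {p} a≡1
      }

    -- The lift of a growing cycle

    module Lifts {m : ℕ} (σ : Cycle f p (2 ℕ.+ m)) (g : Grows σ) where

      n k : ℕ
      n = 2 ℕ.+ m
      k = len σ

      open Orbit σ using (start; reach; index; it≃point; it-len; len-isPeriod)

      G : GrowsAt k n start
      G = grows⇒growsAt σ g

      -- A lift may start over any point of σ and at any representative: move along the orbit of
      -- `start` first, then change the representative.
      growsAt-over : ∀ i {y} → y ≃ point σ i [ Q n ] → GrowsAt k n y
      growsAt-over i c = growsAt-cong (≃-trans c (Orbit.point≃it σ i)) (growsAt-orbit G (toℕ i))

      -- Walking d steps from y to `start` commutes with j steps, so a return of y becomes a return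
      -- of `start`.
      isPeriod-over : ∀ i {y} → y ≃ point σ i [ Q n ] → IsPeriod (Q n) k y
      isPeriod-over i {y} c j it-j≃ with d , e ← reach i zero =
        len-isPeriod j (≃-trans (it-cong j (≃-sym it-d≃))
          (≃-trans (≃-reflexive (it-comm j d y)) (≃-trans (it-cong d it-j≃) it-d≃)))
        where
        it-d≃ : it d y ≃ start [ Q n ]
        it-d≃ = ≃-trans (it-cong d c) e

      lift-exists : ∃ λ (τ : Cycle f p (suc n)) → τ IsLiftOf σ
      lift-exists = let
          τ , points = orbit-cycle (p ℕ.* k) {{ℕ.m*n≢0 p k}}
                         (returns (growsAt-lift G)) (isPeriod-lift G len-isPeriod)
        in τ , λ j → index (toℕ j) ,
          ≃⇒mod {point τ j} (≃-trans (≃-reflexive (points j)) (it≃point (toℕ j)))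

      -- From the first point of τ, d steps lead over point i of σ, and suitably many turns around σ
      -- then hit w. Hence any lift contains every class over σ, which forces uniqueness.
      lift-covers : ∀ (τ : Cycle f p (suc n)) → τ IsLiftOf σ → ∀ i {w} → w ≃ point σ i [ Q n ] →
                    ∃ λ j → w ≡ point τ j [mod p ℕ.^ suc n ]
      lift-covers τ l i {w} w≃ with i₀ , c ← l zero with d , e ← reach i₀ i =
        Orbit.index τ (t ℕ.* k ℕ.+ d) ,
        ≃⇒mod (≃-trans (≃-sym it-t≃w)
          (≃-trans (≃-reflexive (sym (it-+ (t ℕ.* k) d y))) (Orbit.it≃point τ (t ℕ.* k ℕ.+ d))))
        where
        y = point τ zero
        it-d≃ : it d y ≃ point σ i [ Q n ]
        it-d≃ = ≃-trans (it-cong d (mod⇒≃ c)) e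
        hit = reach-lift (growsAt-over i it-d≃) (≃-trans w≃ (≃-sym it-d≃))
        t = proj₁ hit
        it-t≃w = proj₂ hit

      lift⊆lift : ∀ (τ τ′ : Cycle f p (suc n)) → τ IsLiftOf σ → τ′ IsLiftOf σ →
                  ∀ j → ∃ λ i → point τ j ≡ point τ′ i [mod p ℕ.^ suc n ]
      lift⊆lift τ τ′ l l′ j with i , c ← l j =
        lift-covers τ′ l′ i {point τ j} (mod⇒≃ {point τ j} {point σ i} {p ℕ.^ n} c)

      lift-unique : ∃! _≋_ (_IsLiftOf σ)
      lift-unique = let τ , l = lift-exists in
        τ , l , λ {τ′} l′ → lift⊆lift τ τ′ l l′ , lift⊆lift τ′ τ l′ l

      lift-grows : ∀ (τ : Cycle f p (suc n)) → τ IsLiftOf σ → Grows τ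
      lift-grows τ l =
        growsAt⇒grows τ (subst (λ len → GrowsAt len (suc n) (point τ zero)) pk≡len (growsAt-lift H))
        where
        i = proj₁ (l zero)
        c : point τ zero ≃ point σ i [ Q n ]
        c = mod⇒≃ {point τ zero} {point σ i} {p ℕ.^ n} (proj₂ (l zero))
        H : GrowsAt k n (point τ zero)
        H = growsAt-over i c
        -- Both numbers are return times of the first point of τ, and each divides every return
        -- time.
        pk≡len : p ℕ.* k ≡ len τ
        pk≡len = ℕ.∣-antisym
          (isPeriod-lift H (isPeriod-over i c) (len τ) (Orbit.it-len τ))
          (Orbit.len-isPeriod τ (p ℕ.* k) (returns (growsAt-lift H)))

    -- The bound on n travels with growth, making the pair an invariant for the induction over
    -- successive lifts.
    lift-grows : ∀ {n} (σ : Cycle f p n) (τ : Cycle f p (suc n)) →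
                 2 ≤ n × Grows σ → τ IsLiftOf σ → 2 ≤ suc n × Grows τ
    -- Matching the bound puts n into the form 2 + m that `Lifts` expects.
    lift-grows σ τ (2≤n@(s≤s (s≤s z≤n)) , g) l = ℕ.m≤n⇒m≤1+n 2≤n , Lifts.lift-grows σ g τ l

    successive-lift-grows : ∀ {n m} (σ : Cycle f p n) (ρ : Cycle f p m) → 2 ≤ n × Grows σ →
                            ρ IsSuccessiveLiftOf σ → 2 ≤ m × Grows ρ
    successive-lift-grows σ τ g (lift l)                = lift-grows σ τ g l
    successive-lift-grows σ τ g (next-lift {ρ = ρ} s l) =
      lift-grows ρ τ (successive-lift-grows σ ρ g s) l

    lift-unique : ∀ {n} (σ : Cycle f p n) → 2 ≤ n × Grows σ → ∃! _≋_ (_IsLiftOf σ)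
    lift-unique σ (s≤s (s≤s z≤n) , g) = Lifts.lift-unique σ g

mainTheorem3 : ∀ (p : ℕ) .{{_ : NonZero p}} → Prime p → ¬ (2 ∣ p) →
    ∀ (f : ℤ[x]) (n : ℕ) → 2 ≤ n →
    ∀ (σ : Cycle f p n) → Grows σ →
    (∃! _≋_ (_IsLiftOf σ) × (∀ (τ : Cycle f p (ℕ.suc n)) → τ IsLiftOf σ → Grows τ))
    × (∀ (m : ℕ) (ρ : Cycle f p m) → ρ IsSuccessiveLiftOf σ →
    Grows ρ × ∃! _≋_ (_IsLiftOf ρ))
mainTheorem3 p pr 2∤p f n 2≤n σ g =
  (lift-unique σ (2≤n , g) , λ τ l → proj₂ (lift-grows σ τ (2≤n , g) l)) ,
  λ m ρ s → let h = successive-lift-grows σ ρ (2≤n , g) s in proj₂ h , lift-unique ρ h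
  where open Dynamics.OddPrime f pr 2∤p
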